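{- For every integer $k\ge 0$ and $n=12k+6$, there is a transitive avoidance game on $n$ points, with all lines of size $3$, that is a Player I win.
   Context: An avoidance game consists of a finite set $X$ (the board) and a family $\mathcal{L}$ of subsets of $X$ (the lines). Two players, Player I and Player II, alternately claim previously unclaimed points of $X$, Player I moving first. The first player to have claimed all points of some line loses; if all points have been claimed and neither player has completed a line, the game is a draw. The game is transitive if its automorphism group (the group of permutations of $X$ mapping $\mathcal{L}$ onto $\mathcal{L}$) acts transitively on $X$. The game is a Player I win if Player I has a strategy guaranteeing that Player II loses. -}

module Defs where

open import Data.Nat using (ℕ)
open import Data.Fin using (Fin; _≟_)
open import Data.Fin.Subset using (Subset; _∈_)
open import Data.Fin.Permutation using (Permutation′; _⟨$⟩ʳ_; _⟨$⟩ˡ_)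
open import Data.Vec using (tabulate; lookup)
open import Data.List using (List)
open import Data.List.Relation.Unary.All using (All)
open import Data.List.Membership.Propositional renaming (_∈_ to _∈ₗ_)
open import Data.Maybe using (Maybe; just; nothing)
open import Data.Product using (Σ; ∃; _×_)
open import Data.Sum using (_⊎_)
open import Relation.Nullary using (¬_; yes; no)
open import Relation.Binary.PropositionalEquality using (_≡_)

-- An avoidance game on the board Fin n: a finite family of lines,
-- each line a subset of the board.  (The family is a set; a list
-- representation with possible repetitions denotes the same family.)
Lines : ℕ → Set
Lines n = List (Subset n)

image : ∀ {n} → Permutation′ n → Subset n → Subset n
image σ ℓ = tabulate (λ j → lookup ℓ (σ ⟨$⟩ˡ j))

IsAutomorphism : ∀ {n} → Lines n → Permutation′ n → Set
IsAutomorphism L σ =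
  All (λ ℓ → image σ ℓ ∈ₗ L) L ×
  All (λ ℓ → Σ (Subset _) λ ℓ′ → ℓ′ ∈ₗ L × image σ ℓ′ ≡ ℓ) L

IsTransitive : ∀ {n} → Lines n → Set
IsTransitive {n} L =
  (x y : Fin n) → Σ (Permutation′ n) λ σ → IsAutomorphism L σ × σ ⟨$⟩ʳ x ≡ y

AllLinesOfSize : ∀ {n} → ℕ → Lines n → Set
AllLinesOfSize k L = All (λ ℓ → Data.Fin.Subset.∣ ℓ ∣ ≡ k) L

data Player : Set where
  I II : Player

Position : ℕ → Set
Position n = Fin n → Maybe Player

empty : ∀ {n} → Position n
empty _ = nothing

claim : ∀ {n} → Position n → Fin n → Player → Position n
claim pos x p y with y ≟ x
... | yes _ = just p
... | no _ = pos y

Completes : ∀ {n} → Lines n → Position n → Player → Set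
Completes L pos p = Σ _ λ ℓ → ℓ ∈ₗ L × (∀ y → y ∈ ℓ → pos y ≡ just p)

-- Player I can force that Player II loses, from a position (reached
-- with no line completed) where it is I's turn (IWinsFromI) or II's
-- turn (IWinsFromII).  A full board with no completed line is a draw,
-- so there is no winning position without a move available.
mutual
  data IWinsFromI {n} (L : Lines n) (pos : Position n) : Set where
    move : (x : Fin n) → pos x ≡ nothing →
           ¬ Completes L (claim pos x I) I →
           IWinsFromII L (claim pos x I) →
           IWinsFromI L pos

  data IWinsFromII {n} (L : Lines n) (pos : Position n) : Set where
    respond : ∃ (λ x → pos x ≡ nothing) →
              ((x : Fin n) → pos x ≡ nothing →
                 Completes L (claim pos x II) II ⊎
                 IWinsFromI L (claim pos x II)) →
              IWinsFromII L pos

IsPlayerIWin : ∀ {n} → Lines n → Set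
IsPlayerIWin L = IWinsFromI L empty

{-# OPTIONS --safe #-}
-- The blocks of the 2-(6,3,2) design form a transitive game on six points that
-- Player I wins.  Take 2k+1 disjoint copies of it.  One copy is
-- the centre and the others are paired.  Player I opens in the centre, where he
-- follows a winning strategy of the six-point game, and answers any move in another
-- copy by the same move in its twin; so he completes a line there only if Player II
-- has already done so.
module Submission where

open import Defs
import Data.Bool.Properties as Bool
open import Data.Fin using (Fin; zero; suc; combine; _≟_)
open import Data.Fin.Patterns using (0F; 1F; 2F; 3F; 4F; 5F)
open import Data.Fin.Permutation
  using (Permutation′; _⟨$⟩ʳ_; _⟨$⟩ˡ_; _∘ₚ_; inverseˡ; inverseʳ; transpose)
open import Data.Fin.Properties
  using (all?; any?; sequence; combine-surjective; combine-injectiveˡ;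
         combine-injectiveʳ; *↔×; remQuot-combine; suc-injective)
open import Data.Fin.Subset using (Subset; inside; outside; ⊥; ⁅_⁆; _∪_; _∈_; _⊂_; ∣_∣)
open import Data.Fin.Subset.Induction using (Acc; acc; ⊂-wellFounded)
open import Data.Fin.Subset.Properties using (_∈?_; ∣⊥∣≡0; ⊂-trans)
open import Data.List using ([]; _∷_; foldr; allFin; cartesianProductWith)
open import Data.List.Membership.Propositional using (find; lose) renaming (_∈_ to _∈ₗ_)
open import Data.List.Membership.Propositional.Properties
  using (∈-cartesianProductWith⁺; ∈-cartesianProductWith⁻; ∈-allFin)
import Data.List.Membership.DecPropositional as DecMembership
open import Data.List.Relation.Unary.All as All using (All)
open import Data.List.Relation.Unary.Any as Any using ()
open import Data.Maybe as Maybe using (Maybe; just; nothing; is-nothing; _<∣>_; _>>=_; from-just)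
import Data.Maybe.Effectful as Maybe
import Data.Maybe.Properties as Maybe
open import Data.Nat as Nat using (ℕ; zero; suc; _+_; _*_)
open import Data.Nat.Properties using (+-identityʳ)
open import Data.Nat.Tactic.RingSolver using (solve-∀)
open import Data.Product using (Σ; ∃; _×_; _,_; proj₂)
open import Data.Product.Function.NonDependent.Propositional using (_×-↔_)
open import Data.Sum using (_⊎_; inj₁; inj₂)
open import Data.Vec using (lookup; tabulate; _++_; []; _∷_)
open import Data.Vec.Properties as Vec
  using (lookup-++ˡ; lookup-++ʳ; lookup-replicate; lookup∘tabulate; tabulate∘lookup;
         tabulate-cong; []=⇒lookup; lookup⇒[]=)
open import Function using (_∘_; case_of_)
open import Function.Construct.Composition using (_↔-∘_)
open import Function.Construct.Symmetry using (↔-sym)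
open import Relation.Binary using (DecidableEquality)
open import Relation.Binary.PropositionalEquality
open import Relation.Nullary using (¬_; Dec; yes; no; contradiction)
open import Relation.Nullary.Decidable
  using (map′; ¬?; _×-dec_; _→-dec_; dec⇒maybe; from-yes)

private
  variable
    n c : ℕ
    L : Lines n
    pos pos′ : Position n
    p q : Player

-- Positions and lines

claim-≡ : (pos : Position n) (x : Fin n) (p : Player) → claim pos x p x ≡ just p
claim-≡ pos x p with x ≟ x
... | yes _ = refl
... | no x≢x = contradiction refl x≢x

claim-≢ : (pos : Position n) {x y : Fin n} → y ≢ x → claim pos x p y ≡ pos y
claim-≢ pos {x} {y} y≢x with y ≟ x
... | yes y≡x = contradiction y≡x y≢x
... | no _ = refl

-- Two comparisons are covered at once: `f` is the identity between the centre and the single game,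
-- and `swap` between a copy and its twin.
claim-relate : (f : Maybe Player → Maybe Player) → f (just q) ≡ just p →
               (∀ y → pos′ y ≡ f (pos y)) → ∀ x y → claim pos′ x p y ≡ f (claim pos x q y)
claim-relate f fq≡p eq x y with y ≟ x
... | yes _ = sym fq≡p
... | no _ = eq y

free : Position n → Subset n
free pos = tabulate (is-nothing ∘ pos)

∈-free⁻ : (pos : Position n) {y : Fin n} → y ∈ free pos → pos y ≡ nothing
∈-free⁻ pos {y} y∈ with pos y | trans (sym (lookup∘tabulate (is-nothing ∘ pos) y)) ([]=⇒lookup y∈)
... | nothing | _ = refl

∈-free⁺ : (pos : Position n) {y : Fin n} → pos y ≡ nothing → y ∈ free pos
∈-free⁺ pos {y} eq = lookup⇒[]= y _
  (trans (lookup∘tabulate (is-nothing ∘ pos) y) (cong is-nothing eq))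

-- This provides the termination measure of the mirror strategy. A mirrored exchange does not
-- advance the strategy tree of the centre, so recursion on that tree would not be structural.
free-claim-⊂ : (pos : Position n) {x : Fin n} → pos x ≡ nothing → free (claim pos x p) ⊂ free pos
free-claim-⊂ {p = p} pos {x} x-free = sub , x , ∈-free⁺ pos x-free , x∉
  where
  x∉ : ¬ x ∈ free (claim pos x p)
  x∉ x∈ with () ← trans (sym (claim-≡ pos x p)) (∈-free⁻ (claim pos x p) x∈)

  sub : ∀ {y} → y ∈ free (claim pos x p) → y ∈ free pos
  sub {y} y∈ with y ≟ x
  ... | yes refl = contradiction y∈ x∉
  ... | no y≢x = ∈-free⁺ pos (trans (sym (claim-≢ pos y≢x)) (∈-free⁻ (claim pos x p) y∈))

completes-map : (∀ y → pos y ≡ just p → pos′ y ≡ just q) → Completes L pos p → Completes L pos′ q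
completes-map f (ℓ , ℓ∈L , h) = ℓ , ℓ∈L , λ y → f y ∘ h y

opponent : Player → Player
opponent I = II
opponent II = I

swap : Maybe Player → Maybe Player
swap = Maybe.map opponent

swap-involutive : ∀ m → swap (swap m) ≡ m
swap-involutive nothing = refl
swap-involutive (just I) = refl
swap-involutive (just II) = refl

_≟ₚ_ : DecidableEquality Player
I ≟ₚ I = yes refl
I ≟ₚ II = no λ ()
II ≟ₚ I = no λ ()
II ≟ₚ II = yes refl

completes? : (L : Lines n) (pos : Position n) (p : Player) → Dec (Completes L pos p)
completes? L pos p = map′ find (λ (_ , ℓ∈L , h) → lose ℓ∈L h)
  (Any.any? (λ ℓ → all? λ y → (y ∈? ℓ) →-dec (Maybe.≡-dec _≟ₚ_ (pos y) (just p))) L)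

-- Disjoint copies of a game

-- The recursion follows that of `combine`, so `combine i y` is the point `y` of copy `i`.
embed : Fin c → Subset n → Subset (c * n)
embed zero ℓ = ℓ ++ ⊥
embed {n = n} (suc i) ℓ = ⊥ {n} ++ embed i ℓ

copies : (c : ℕ) → Lines n → Lines (c * n)
copies c L = cartesianProductWith embed (allFin c) L

∣++∣ : ∀ {m n} (s : Subset m) (t : Subset n) → ∣ s ++ t ∣ ≡ ∣ s ∣ + ∣ t ∣
∣++∣ [] t = refl
∣++∣ (inside ∷ s) t = cong suc (∣++∣ s t)
∣++∣ (outside ∷ s) t = ∣++∣ s t

∣embed∣ : (i : Fin c) (ℓ : Subset n) → ∣ embed i ℓ ∣ ≡ ∣ ℓ ∣
∣embed∣ {suc c} {n} zero ℓ =
  trans (∣++∣ ℓ ⊥) (trans (cong (∣ ℓ ∣ +_) (∣⊥∣≡0 (c * n))) (+-identityʳ _))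
∣embed∣ {suc c} {n} (suc i) ℓ =
  trans (∣++∣ (⊥ {n}) (embed i ℓ)) (cong₂ _+_ (∣⊥∣≡0 n) (∣embed∣ i ℓ))

lookup-⊥ : (y : Fin n) → lookup ⊥ y ≡ outside
lookup-⊥ y = lookup-replicate y outside

lookup-embed-≡ : (i : Fin c) (ℓ : Subset n) (y : Fin n) →
                 lookup (embed i ℓ) (combine i y) ≡ lookup ℓ y
lookup-embed-≡ zero ℓ y = lookup-++ˡ ℓ ⊥ y
lookup-embed-≡ {n = n} (suc i) ℓ y =
  trans (lookup-++ʳ (⊥ {n}) (embed i ℓ) (combine i y)) (lookup-embed-≡ i ℓ y)

lookup-embed-≢ : {i j : Fin c} (ℓ : Subset n) → i ≢ j → (y : Fin n) →
                 lookup (embed i ℓ) (combine j y) ≡ outside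
lookup-embed-≢ {i = zero} {zero} ℓ i≢j y = contradiction refl i≢j
lookup-embed-≢ {i = zero} {suc j} ℓ i≢j y =
  trans (lookup-++ʳ ℓ ⊥ (combine j y)) (lookup-⊥ (combine j y))
lookup-embed-≢ {n = n} {i = suc i} {zero} ℓ i≢j y =
  trans (lookup-++ˡ (⊥ {n}) (embed i ℓ) y) (lookup-⊥ y)
lookup-embed-≢ {n = n} {i = suc i} {suc j} ℓ i≢j y =
  trans (lookup-++ʳ (⊥ {n}) (embed i ℓ) (combine j y)) (lookup-embed-≢ ℓ (i≢j ∘ cong suc) y)

embed∈copies : (i : Fin c) {ℓ : Subset n} → ℓ ∈ₗ L → embed i ℓ ∈ₗ copies c L
embed∈copies i = ∈-cartesianProductWith⁺ embed (∈-allFin i)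

all-copies : (c : ℕ) (L : Lines n) {P : Subset (c * n) → Set} →
             (∀ i {ℓ} → ℓ ∈ₗ L → P (embed i ℓ)) → All P (copies c L)
all-copies c L h = All.tabulate λ ℓ∈ → case ∈-cartesianProductWith⁻ embed (allFin c) L ℓ∈ of
  λ where (i , _ , _ , ℓ∈L , refl) → h i ℓ∈L

completes-copies⁻ : (c : ℕ) (L : Lines n) {pos : Position (c * n)} → Completes (copies c L) pos p →
                    ∃ λ (i : Fin c) → Completes L (pos ∘ combine i) p
completes-copies⁻ c L (_ , ℓ∈ , h) with ∈-cartesianProductWith⁻ embed (allFin c) L ℓ∈
... | i , ℓ , _ , ℓ∈L , refl = i , ℓ , ℓ∈L , λ y y∈ℓ →
  h (combine i y) (lookup⇒[]= _ _ (trans (lookup-embed-≡ i ℓ y) ([]=⇒lookup y∈ℓ)))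

completes-copies⁺ : {pos : Position (c * n)} (i : Fin c) →
                    Completes L (pos ∘ combine i) p → Completes (copies c L) pos p
completes-copies⁺ {c = c} {n = n} {p = p} {pos = pos} i (ℓ , ℓ∈L , h) = embed i ℓ , embed∈copies i ℓ∈L , h′
  where
  h′ : ∀ x → x ∈ embed i ℓ → pos x ≡ just p
  h′ x x∈ with combine-surjective {c} {n} x
  ... | j , y , refl with i ≟ j
  ...   | yes refl = h y (lookup⇒[]= y ℓ (trans (sym (lookup-embed-≡ i ℓ y)) ([]=⇒lookup x∈)))
  ...   | no i≢j with () ← trans (sym ([]=⇒lookup x∈)) (lookup-embed-≢ ℓ i≢j y)

copies-size : (c : ℕ) {L : Lines n} {k : ℕ} → AllLinesOfSize k L → AllLinesOfSize k (copies c L)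
copies-size c {L} size = all-copies c L λ i {ℓ} ℓ∈L → trans (∣embed∣ i ℓ) (All.lookup size ℓ∈L)

-- `π` permutes the copies and `σ` acts alike inside each. Such maps suffice for transitivity: `π`
-- brings one copy to another, and `σ` then adjusts the point.
product : Permutation′ c → Permutation′ n → Permutation′ (c * n)
product π σ = ↔-sym *↔× ↔-∘ ((π ×-↔ σ) ↔-∘ *↔×)

product-combineʳ : (π : Permutation′ c) (σ : Permutation′ n) (i : Fin c) (y : Fin n) →
                   product π σ ⟨$⟩ʳ combine i y ≡ combine (π ⟨$⟩ʳ i) (σ ⟨$⟩ʳ y)
product-combineʳ π σ i y =
  cong (λ (j , z) → combine (π ⟨$⟩ʳ j) (σ ⟨$⟩ʳ z)) (remQuot-combine i y)

product-combineˡ : (π : Permutation′ c) (σ : Permutation′ n) (i : Fin c) (y : Fin n) →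
                   product π σ ⟨$⟩ˡ combine i y ≡ combine (π ⟨$⟩ˡ i) (σ ⟨$⟩ˡ y)
product-combineˡ π σ i y =
  cong (λ (j , z) → combine (π ⟨$⟩ˡ j) (σ ⟨$⟩ˡ z)) (remQuot-combine i y)

-- `image` reads a set through the inverse permutation. With the source copy written as `π ⟨$⟩ˡ i`,
-- the single test `i ≟ j` settles both sides. `onto′` uses this form as it is, `into′` after
-- cancelling `π` against its inverse.
image-embed : (π : Permutation′ c) (σ : Permutation′ n) (i : Fin c) (ℓ : Subset n) →
              image (product π σ) (embed (π ⟨$⟩ˡ i) ℓ) ≡ embed i (image σ ℓ)
image-embed {c} {n} π σ i ℓ = trans (tabulate-cong pointwise) (tabulate∘lookup (embed i (image σ ℓ)))
  where
  block : ∀ j y → lookup (embed (π ⟨$⟩ˡ i) ℓ) (combine (π ⟨$⟩ˡ j) (σ ⟨$⟩ˡ y)) ≡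
                  lookup (embed i (image σ ℓ)) (combine j y)
  block j y with i ≟ j
  ... | yes refl = begin
    lookup (embed (π ⟨$⟩ˡ i) ℓ) (combine (π ⟨$⟩ˡ i) (σ ⟨$⟩ˡ y)) ≡⟨ lookup-embed-≡ (π ⟨$⟩ˡ i) ℓ _ ⟩
    lookup ℓ (σ ⟨$⟩ˡ y)                                         ≡⟨ lookup∘tabulate _ y ⟨
    lookup (image σ ℓ) y                                        ≡⟨ lookup-embed-≡ i _ y ⟨
    lookup (embed i (image σ ℓ)) (combine i y)                  ∎
    where open ≡-Reasoning
  ... | no i≢j = trans (lookup-embed-≢ ℓ π⁻¹i≢π⁻¹j _) (sym (lookup-embed-≢ _ i≢j y))
    where
    π⁻¹i≢π⁻¹j : π ⟨$⟩ˡ i ≢ π ⟨$⟩ˡ j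
    π⁻¹i≢π⁻¹j eq = i≢j (trans (sym (inverseʳ π)) (trans (cong (π ⟨$⟩ʳ_) eq) (inverseʳ π)))

  pointwise : ∀ x → lookup (embed (π ⟨$⟩ˡ i) ℓ) (product π σ ⟨$⟩ˡ x) ≡ lookup (embed i (image σ ℓ)) x
  pointwise x with combine-surjective {c} {n} x
  ... | j , y , refl = trans (cong (lookup (embed (π ⟨$⟩ˡ i) ℓ)) (product-combineˡ π σ j y)) (block j y)

product-automorphism : (π : Permutation′ c) (σ : Permutation′ n) →
                       IsAutomorphism L σ → IsAutomorphism (copies c L) (product π σ)
product-automorphism {c} {n} {L} π σ (into , onto) = all-copies c L into′ , all-copies c L onto′
  where
  into′ : ∀ i {ℓ} → ℓ ∈ₗ L → image (product π σ) (embed i ℓ) ∈ₗ copies c L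
  into′ i {ℓ} ℓ∈L = subst (_∈ₗ copies c L) (sym eq) (embed∈copies (π ⟨$⟩ʳ i) (All.lookup into ℓ∈L))
    where
    eq : image (product π σ) (embed i ℓ) ≡ embed (π ⟨$⟩ʳ i) (image σ ℓ)
    eq = trans (cong (λ j → image (product π σ) (embed j ℓ)) (sym (inverseˡ π)))
               (image-embed π σ (π ⟨$⟩ʳ i) ℓ)

  onto′ : ∀ i {ℓ} → ℓ ∈ₗ L →
          Σ (Subset (c * n)) λ ℓ′ → ℓ′ ∈ₗ copies c L × image (product π σ) ℓ′ ≡ embed i ℓ
  onto′ i ℓ∈L with All.lookup onto ℓ∈L
  ... | ℓ′ , ℓ′∈L , refl = embed (π ⟨$⟩ˡ i) ℓ′ , embed∈copies (π ⟨$⟩ˡ i) ℓ′∈L , image-embed π σ i ℓ′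

transpose-≡ : (i j : Fin n) → transpose i j ⟨$⟩ʳ i ≡ j
transpose-≡ i j with i ≟ i
... | yes _ = refl
... | no i≢i = contradiction refl i≢i

copies-transitive : (c : ℕ) {L : Lines n} → IsTransitive L → IsTransitive (copies c L)
copies-transitive {n} c {L} transitive x y
  with combine-surjective {c} {n} x | combine-surjective {c} {n} y
... | i , u , refl | j , v , refl with transitive u v
...   | σ , σ-auto , refl =
  -- If `i` and `j` coincide, the transposition is the identity, so points of one copy need no
  -- separate case.
  product (transpose i j) σ ,
  product-automorphism {L = L} (transpose i j) σ σ-auto ,
  trans (product-combineʳ (transpose i j) σ i u) (cong (λ k → combine k (σ ⟨$⟩ʳ u)) (transpose-≡ i j))

claim-same-copy : (pos : Position (c * n)) (i : Fin c) (x y : Fin n) →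
                  claim pos (combine i x) p (combine i y) ≡ claim (pos ∘ combine i) x p y
claim-same-copy pos i x y with y ≟ x
... | yes refl = claim-≡ pos (combine i x) _
... | no y≢x = claim-≢ pos (y≢x ∘ combine-injectiveʳ i y i x)

claim-other-copy : (pos : Position (c * n)) {i j : Fin c} → j ≢ i → (x y : Fin n) →
                   claim pos (combine i x) p (combine j y) ≡ pos (combine j y)
claim-other-copy pos {i} {j} j≢i x y = claim-≢ pos (j≢i ∘ combine-injectiveˡ j y i x)

-- The mirror strategy

module Mirror (o : Fin c) (τ : Fin c → Fin c)
              (τ-involutive : ∀ i → τ (τ i) ≡ i) (τ-o : τ o ≡ o)
              (τ-fixed : ∀ i → τ i ≡ i → i ≡ o)
              (L : Lines n) where

  τ-≢o : ∀ {i} → i ≢ o → τ i ≢ o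
  τ-≢o {i} i≢o τi≡o = i≢o (trans (sym (τ-involutive i)) (trans (cong τ τi≡o) τ-o))

  Mirrored : Position (c * n) → Fin c → Set
  Mirrored pos i = ∀ y → pos (combine (τ i) y) ≡ swap (pos (combine i y))

  mirrored-τ : (pos : Position (c * n)) (i : Fin c) → Mirrored pos i → Mirrored pos (τ i)
  mirrored-τ pos i mirrored y = begin
    pos (combine (τ (τ i)) y)      ≡⟨ cong (λ j → pos (combine j y)) (τ-involutive i) ⟩
    pos (combine i y)              ≡⟨ swap-involutive _ ⟨
    swap (swap (pos (combine i y))) ≡⟨ cong swap (mirrored y) ⟨
    swap (pos (combine (τ i) y))   ∎
    where open ≡-Reasoning

  -- The invariant of the strategy, restored by every move of Player I. The centre is exempt from
  -- mirroring: as `τ` fixes it, mirroring would force it to stay empty. It follows a position `P`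
  -- of the single game instead.
  record Balanced (P : Position n) (pos : Position (c * n)) : Set where
    field
      centre : ∀ y → pos (combine o y) ≡ P y
      mirror : ∀ i → i ≢ o → Mirrored pos i

  open Balanced

  claim-centre : ∀ {P pos x} → Balanced P pos → Balanced (claim P x p) (claim pos (combine o x) p)
  claim-centre {P = P} {pos} {x} bal .centre y =
    trans (claim-same-copy pos o x y) (claim-relate (λ m → m) refl (centre bal) x y)
  claim-centre {P = P} {pos} {x} bal .mirror i i≢o y = begin
    claim pos (combine o x) _ (combine (τ i) y)    ≡⟨ claim-other-copy pos (τ-≢o i≢o) x y ⟩
    pos (combine (τ i) y)                          ≡⟨ mirror bal i i≢o y ⟩
    swap (pos (combine i y))                       ≡⟨ cong swap (claim-other-copy pos i≢o x y) ⟨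
    swap (claim pos (combine o x) _ (combine i y)) ∎
    where open ≡-Reasoning

  claim-mirror : ∀ {P pos i x} → i ≢ o → Balanced P pos →
                 Balanced P (claim (claim pos (combine i x) p) (combine (τ i) x) (opponent p))
  claim-mirror {p = p} {P} {pos} {i} {x} i≢o bal = record { centre = centre′ ; mirror = mirror′ }
    where
    open ≡-Reasoning

    pos₁ = claim pos (combine i x) p
    pos₂ = claim pos₁ (combine (τ i) x) (opponent p)

    unchanged : ∀ {j} → j ≢ i → j ≢ τ i → ∀ y → pos₂ (combine j y) ≡ pos (combine j y)
    unchanged j≢i j≢τi y =
      trans (claim-other-copy pos₁ j≢τi x y) (claim-other-copy pos j≢i x y)

    centre′ : ∀ y → pos₂ (combine o y) ≡ P y
    centre′ y = trans (unchanged (i≢o ∘ sym) (τ-≢o i≢o ∘ sym) y) (centre bal y)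

    τi≢i : τ i ≢ i
    τi≢i = i≢o ∘ τ-fixed i

    mirrored-i : Mirrored pos₂ i
    mirrored-i y = begin
      pos₂ (combine (τ i) y)
        ≡⟨ claim-same-copy pos₁ (τ i) x y ⟩
      claim (pos₁ ∘ combine (τ i)) x (opponent p) y
        ≡⟨ claim-relate swap refl
             (λ z → trans (claim-other-copy pos τi≢i x z) (mirror bal i i≢o z)) x y ⟩
      swap (claim (pos ∘ combine i) x p y)
        ≡⟨ cong swap (claim-same-copy pos i x y) ⟨
      swap (pos₁ (combine i y))
        ≡⟨ cong swap (claim-other-copy pos₁ (τi≢i ∘ sym) x y) ⟨
      swap (pos₂ (combine i y)) ∎

    mirror′ : ∀ j → j ≢ o → Mirrored pos₂ j
    -- Only the copies `i` and `τ i` have changed. Mirroring is symmetric, so one of them settles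
    -- the other; for any further `j`, injectivity of `τ` keeps `τ j` away from both as well.
    mirror′ j j≢o with j ≟ i | j ≟ τ i
    ... | yes refl | _ = mirrored-i
    ... | no _ | yes refl = mirrored-τ pos₂ i mirrored-i
    ... | no j≢i | no j≢τi = λ y → begin
      pos₂ (combine (τ j) y)   ≡⟨ unchanged τj≢i τj≢τi y ⟩
      pos (combine (τ j) y)    ≡⟨ mirror bal j j≢o y ⟩
      swap (pos (combine j y)) ≡⟨ cong swap (unchanged j≢i j≢τi y) ⟨
      swap (pos₂ (combine j y)) ∎
      where
      τj≢i : τ j ≢ i
      τj≢i eq = j≢τi (trans (sym (τ-involutive j)) (cong τ eq))

      τj≢τi : τ j ≢ τ i
      τj≢τi eq = j≢i (trans (sym (τ-involutive j)) (trans (cong τ eq) (τ-involutive i)))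

  -- Balance is assumed only after the move, since a move of Player II in a non-central copy breaks
  -- it for the moment. A line of Player I outside the centre would have a twin in Player II's
  -- colour. The move at `x` gives Player II no point, so that twin was already complete in `pos`,
  -- against the assumption on `pos`.
  I-safe : ∀ {P x} → Balanced P (claim pos x I) → ¬ Completes L P I →
           ¬ Completes (copies c L) pos II → ¬ Completes (copies c L) (claim pos x I) I
  I-safe {pos = pos} {x = x} bal centre-safe II-safe completed with completes-copies⁻ c L completed
  ... | i , completedᵢ with i ≟ o
  ...   | yes refl = centre-safe (completes-map (λ y eq → trans (sym (centre bal y)) eq) completedᵢ)
  ...   | no i≢o = II-safe (completes-copies⁺ (τ i) (completes-map by-II completedᵢ))
    where
    unclaim : ∀ z → claim pos x I z ≡ just II → pos z ≡ just II
    unclaim z eq with z ≟ x | eq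
    ... | yes _ | ()
    ... | no _ | eq′ = eq′

    by-II : ∀ y → claim pos x I (combine i y) ≡ just I → pos (combine (τ i) y) ≡ just II
    by-II y eq = unclaim _ (trans (mirror bal i i≢o y) (cong swap eq))

  mutual
    -- Entered at the start and after a move of Player II in the centre, when the strategy for the
    -- single game is to move.
    winFromI : ∀ {P pos} → Acc _⊂_ (free pos) → Balanced P pos →
               ¬ Completes (copies c L) pos II → IWinsFromI L P → IWinsFromI (copies c L) pos
    winFromI {pos = pos} (acc rec) bal II-safe (move x x-free x-safe win) =
      move (combine o x) ox-free (I-safe bal′ x-safe II-safe)
           (winFromII (rec (free-claim-⊂ pos ox-free)) bal′ x-safe win)
      where
      ox-free = trans (centre bal x) x-free
      bal′ = claim-centre bal

    winFromII : ∀ {P pos} → Acc _⊂_ (free pos) → Balanced P pos →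
                ¬ Completes L P I → IWinsFromII L P → IWinsFromII (copies c L) pos
    winFromII {P} {pos} (acc rec) bal centre-safe win@(respond (e , e-free) reply) =
      -- No draw can occur: whenever Player II is to move, the centre strategy itself guarantees a
      -- free point there.
      respond (combine o e , trans (centre bal e) e-free) reply′
      where
      answer : ∀ i x → pos (combine i x) ≡ nothing →
               ¬ Completes (copies c L) (claim pos (combine i x) II) II →
               IWinsFromI (copies c L) (claim pos (combine i x) II)
      answer i x x-free II-safe with i ≟ o
      answer .o x x-free II-safe | yes refl with reply x (trans (sym (centre bal x)) x-free)
      -- A line completed in the centre is a line of the whole game, a case already excluded by
      -- `II-safe`.
      ... | inj₁ completed = contradiction
        (completes-copies⁺ o (completes-map (λ y → trans (centre (claim-centre bal) y)) completed))
        II-safe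
      ... | inj₂ win′ = winFromI (rec (free-claim-⊂ pos x-free)) (claim-centre bal) II-safe win′
      answer i x x-free II-safe | no i≢o =
        -- The centre is untouched, so `win` and `centre-safe` are passed on unchanged; only the set
        -- of free points has shrunk, by two claims.
        move (combine (τ i) x) τx-free (I-safe bal′ centre-safe II-safe)
             (winFromII (rec (⊂-trans (free-claim-⊂ pos₁ τx-free) (free-claim-⊂ pos x-free)))
                        bal′ centre-safe win)
        where
        pos₁ = claim pos (combine i x) II
        bal′ = claim-mirror i≢o bal
        τx-free : pos₁ (combine (τ i) x) ≡ nothing
        -- Since `τ i` differs from `i`, Player II's move did not take the twin point, which was
        -- free because `x` was.
        τx-free = trans (claim-other-copy pos (i≢o ∘ τ-fixed i) x x)
                        (trans (mirror bal i i≢o x) (cong swap x-free))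

      reply′ : ∀ x → pos x ≡ nothing → Completes (copies c L) (claim pos x II) II ⊎
                                       IWinsFromI (copies c L) (claim pos x II)
      -- Whether Player II has just lost on the whole board is decided first; the answer may then
      -- assume `II-safe`, which `I-safe` requires.
      reply′ x x-free with completes? (copies c L) (claim pos x II) II | combine-surjective {c} {n} x
      ... | yes completed | _ = inj₁ completed
      ... | no II-safe | i , y , refl = inj₂ (answer i y x-free II-safe)

  copies-win : IsPlayerIWin L → IsPlayerIWin (copies c L)
  copies-win win@(move x _ x-safe _) =
    winFromI (⊂-wellFounded _) (record { centre = λ _ → refl ; mirror = λ _ _ _ → refl }) II-safe win
    where
    -- Only the empty line is complete on the empty board, and x-safe excludes it.
    II-safe : ¬ Completes (copies c L) empty II
    II-safe completed = x-safe (completes-map (λ _ ()) (proj₂ (completes-copies⁻ c L completed)))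

-- Exchanges `2m` and `2m + 1`. The size is `k * 2` rather than `2 * k` so that `suc k * 2` reduces
-- to two successors and the patterns match.
twin : ∀ k → Fin (k * 2) → Fin (k * 2)
twin (suc k) zero = suc zero
twin (suc k) (suc zero) = zero
twin (suc k) (suc (suc i)) = suc (suc (twin k i))

twin-involutive : ∀ k i → twin k (twin k i) ≡ i
twin-involutive (suc k) zero = refl
twin-involutive (suc k) (suc zero) = refl
twin-involutive (suc k) (suc (suc i)) = cong (λ j → suc (suc j)) (twin-involutive k i)

twin-≢ : ∀ k i → twin k i ≢ i
twin-≢ (suc k) (suc (suc i)) eq = twin-≢ k i (suc-injective (suc-injective eq))

odd-copies-win : ∀ k → IsPlayerIWin L → IsPlayerIWin (copies (1 + k * 2) L)
odd-copies-win {L = L} k = Mirror.copies-win zero τ τ-involutive refl τ-fixed L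
  where
  τ : Fin (1 + k * 2) → Fin (1 + k * 2)
  τ zero = zero
  τ (suc i) = suc (twin k i)

  τ-involutive : ∀ i → τ (τ i) ≡ i
  τ-involutive zero = refl
  τ-involutive (suc i) = cong suc (twin-involutive k i)

  τ-fixed : ∀ i → τ i ≡ i → i ≡ zero
  τ-fixed zero _ = refl
  τ-fixed (suc i) eq = contradiction (suc-injective eq) (twin-≢ k i)
  
-- Game-tree search

mutual
  -- The result is the winning strategy itself, so the search needs no correctness proof. The depth
  -- counts moves of Player I only: `searchII` passes it on unchanged.
  searchI : ℕ → (L : Lines n) (pos : Position n) → Maybe (IWinsFromI L pos)
  searchI zero L pos = nothing
  searchI {n} (suc depth) L pos = foldr (λ x → try x <∣>_) nothing (allFin n)
    where
    try : Fin n → Maybe (IWinsFromI L pos)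
    try x = do
      x-free ← dec⇒maybe (Maybe.≡-dec _≟ₚ_ (pos x) nothing)
      x-safe ← dec⇒maybe (¬? (completes? L (claim pos x I) I))
      win ← searchII depth L (claim pos x I)
      just (move x x-free x-safe win)

  searchII : ℕ → (L : Lines n) (pos : Position n) → Maybe (IWinsFromII L pos)
  searchII {n} depth L pos = do
    x ← dec⇒maybe (any? λ x → Maybe.≡-dec _≟ₚ_ (pos x) nothing)
    reply ← sequence Maybe.applicative try
    just (respond x reply)
    where
    try : (x : Fin n) → Maybe (pos x ≡ nothing →
            Completes L (claim pos x II) II ⊎ IWinsFromI L (claim pos x II))
    try x with Maybe.≡-dec _≟ₚ_ (pos x) nothing
    ... | no taken = just λ x-free → contradiction x-free taken
    ... | yes _ with completes? L (claim pos x II) II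
    ...   | yes completed = just λ _ → inj₁ completed
    ...   | no _ = Maybe.map (λ win _ → inj₂ win) (searchI depth L (claim pos x II))

-- The six-point game

-- The points are those of the projective line over 𝔽₅, with 5F as ∞; the lines
-- are {∞, i, i + 1} and {i, i + 1, i + 3} for i ∈ 𝔽₅.
design : Lines 6
design =
  line 5F 0F 1F ∷ line 5F 1F 2F ∷ line 5F 2F 3F ∷ line 5F 3F 4F ∷ line 5F 4F 0F ∷
  line 0F 1F 3F ∷ line 1F 2F 4F ∷ line 2F 3F 0F ∷ line 3F 4F 1F ∷ line 4F 0F 2F ∷ []
  where
  line : Fin 6 → Fin 6 → Fin 6 → Subset 6
  line x y z = ⁅ x ⁆ ∪ ⁅ y ⁆ ∪ ⁅ z ⁆

design-size : AllLinesOfSize 3 design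
design-size = from-yes (All.all? (λ ℓ → ∣ ℓ ∣ Nat.≟ 3) design)

_≟ₛ_ : DecidableEquality (Subset n)
_≟ₛ_ = Vec.≡-dec Bool._≟_

automorphism? : (L : Lines n) (σ : Permutation′ n) → Dec (IsAutomorphism L σ)
automorphism? L σ =
  All.all? (λ ℓ → image σ ℓ ∈ₗ? L) L ×-dec
  All.all? (λ ℓ → map′ find (λ (_ , ℓ′∈L , eq) → lose ℓ′∈L eq)
                       (Any.any? (λ ℓ′ → image σ ℓ′ ≟ₛ ℓ) L)) L
  where open DecMembership _≟ₛ_ using () renaming (_∈?_ to _∈ₗ?_)

-- The automorphism group contains, for any two points x and y, an involution of
-- the form (x y)(u v).
design-involution : ∀ x y → ∃ λ u → ∃ λ v → let σ = transpose x y ∘ₚ transpose u v in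
                    σ ⟨$⟩ʳ x ≡ y × IsAutomorphism design σ
design-involution = from-yes (all? λ x → all? λ y → any? λ u → any? λ v →
  let σ = transpose x y ∘ₚ transpose u v in (σ ⟨$⟩ʳ x) ≟ y ×-dec automorphism? design σ)

design-transitive : IsTransitive design
design-transitive x y =
  let u , v , eq , auto = design-involution x y in transpose x y ∘ₚ transpose u v , auto , eq

-- Why a strategy exists: of two complementary triples exactly one is a line, so Player I only has
-- to avoid a line with his third point. If he opens with `a` and Player II takes `e`, he takes a
-- `b` for which `a`, `b`, `e` form a line. Only one other point completes a line with `a` and `b`,
-- so one of the last two free points is safe. The depth 6 is ample, as Player I moves at most three
-- times.
design-win : IsPlayerIWin design
design-win = from-just (searchI 6 design empty)

theorem24 : (k : ℕ) →
    Σ (Lines (12 * k + 6)) λ L →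
    AllLinesOfSize 3 L × IsTransitive L × IsPlayerIWin L
theorem24 k = subst (λ n → Σ (Lines n) λ L → AllLinesOfSize 3 L × IsTransitive L × IsPlayerIWin L)
  (points k)
  ( copies (1 + k * 2) design
  , copies-size (1 + k * 2) design-size
  , copies-transitive (1 + k * 2) design-transitive
  , odd-copies-win k design-win )
  where
  points : ∀ k → (1 + k * 2) * 6 ≡ 12 * k + 6
  points = solve-∀
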